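{- Let $n\ge 1$. In the Tamari lattice $\operatorname{Tam}_n$ of size $n$, there are: \begin{itemize} \item $\displaystyle \frac{1}{n+1}\binom{2n}{n}$ linear intervals of height $0$, \item $\displaystyle \binom{2n-1}{n-2}$ linear intervals of height $1$, \item $\displaystyle 2\binom{2n-k}{n-k-1}$ linear intervals of height $k$, for $2\le k<n$. \end{itemize} Furthermore, there are no linear intervals of height $k\ge n$. This adds up to $$\frac{1}{n+1}\binom{2n}{n}+\binom{2n-1}{n-2}+2\binom{2n-1}{n+2}$$ linear intervals in $\operatorname{Tam}_n$.
   Context: Binomial coefficients $\binom{a}{b}$ with $b<0$ or $b>a$ are $0$. Intervals. In a finite poset, for $P\le Q$ the interval $[P,Q]$ is the set of $R$ with $P\le R\le Q$. Its height is the maximal length $k$ of a chain $P=P_0<P_1<\dots<P_k=Q$. It is linear if it is totally ordered. Tamari lattice. A tree is a planar rooted binary tree; its size is its number of (internal) nodes, each node having a left and a right son (each a node or a leaf). $\operatorname{Tam}_n$ is the set of trees of size $n$ ordered by the reflexive transitive closure of left rotations, where a left rotation at a node replaces, somewhere in the tree, a subtree of the form $(B,(C,D))$ by $((B,C),D)$ (here $(X,Y)$ denotes the tree whose root node has left subtree $X$ and right subtree $Y$, and $B,C,D$ are trees, possibly reduced to a leaf); the rotated tree is the larger one. -}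

module Defs where

open import Data.Integer.Base using (ℤ; +_; -[1+_])
open import Data.List.Base using (List; length)
open import Data.Nat.Base using (ℕ; zero; suc; _+_; _*_; _≤_; _<_; s≤s; z≤n)
open import Data.Nat.Combinatorics using (_C_; nC1≡n; nCk+nC[k+1]≡[n+1]C[k+1]; k>n⇒nCk≡0)
open import Data.Nat.Divisibility using (_∣_; ∣m+n∣m⇒∣n; m∣m*n)
open import Data.Nat.Properties
open import Data.Nat.Tactic.RingSolver using (solve-∀)
open import Data.Product.Base using (∃-syntax; _×_; _,_; proj₁)
open import Data.Product.Relation.Binary.Pointwise.NonDependent using (×-setoid)
open import Data.Sum.Base using (_⊎_)
open import Function.Bundles using (_⇔_)
open import Level using (Level; 0ℓ; _⊔_)
open import Relation.Binary.Bundles using (Poset; Setoid)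
open import Relation.Binary.Construct.Closure.ReflexiveTransitive using (Star; ε; _◅_; _◅◅_)
import Relation.Binary.Construct.On as On
open import Relation.Binary.PropositionalEquality
  using (_≡_; refl; sym; trans; cong; cong₂; subst; isEquivalence)
import Relation.Binary.Properties.Poset as PosetProperties
open import Relation.Nullary.Negation using (contradiction)
open import Relation.Unary using (Pred)

import Data.List.Membership.Setoid as Membership
import Data.List.Relation.Unary.Unique.Setoid as Uniqueness

-- Counting up to the setoid equality; meant for predicates that respect it.
HasCount : ∀ {a ℓ p} (S : Setoid a ℓ) → Pred (Setoid.Carrier S) p → ℕ → Set (a ⊔ ℓ ⊔ p)
HasCount S P m =
  ∃[ xs ] (length xs ≡ m × Unique xs × (∀ x → x ∈ xs ⇔ P x))
  where
  open Membership S using (_∈_)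
  open Uniqueness S using (Unique)

module Intervals {a ℓ₁ ℓ₂ : Level} (𝓟 : Poset a ℓ₁ ℓ₂) where

  open Poset 𝓟 using (Carrier; _≈_) renaming (_≤_ to _⊑_)
  open PosetProperties 𝓟 using () renaming (_<_ to _⊏_)

  -- An interval [P , Q] is represented by its pair of endpoints, which it
  -- determines since P ⊑ Q is always required.
  Endpoints : Setoid a ℓ₁
  Endpoints = ×-setoid (Poset.Eq.setoid 𝓟) (Poset.Eq.setoid 𝓟)

  _∈[_,_] : Carrier → Carrier → Carrier → Set ℓ₂
  R ∈[ P , Q ] = P ⊑ R × R ⊑ Q

  IsLinear : Carrier → Carrier → Set (a ⊔ ℓ₂)
  IsLinear P Q = ∀ {R S} → R ∈[ P , Q ] → S ∈[ P , Q ] → R ⊑ S ⊎ S ⊑ R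

  -- Chain P Q k is the type of chains P = P₀ ⊏ P₁ ⊏ … ⊏ Pₖ = Q.
  data Chain : Carrier → Carrier → ℕ → Set (a ⊔ ℓ₁ ⊔ ℓ₂) where
    stop : ∀ {P Q} → P ≈ Q → Chain P Q 0
    step : ∀ {P R Q k} → P ⊏ R → Chain R Q k → Chain P Q (suc k)

  HasHeight : Carrier → Carrier → ℕ → Set (a ⊔ ℓ₁ ⊔ ℓ₂)
  HasHeight P Q k = Chain P Q k × (∀ {j} → Chain P Q j → j ≤ k)

  LinearInterval : Pred (Carrier × Carrier) (a ⊔ ℓ₂)
  LinearInterval (P , Q) = P ⊑ Q × IsLinear P Q

  LinearIntervalOfHeight : ℕ → Pred (Carrier × Carrier) (a ⊔ ℓ₁ ⊔ ℓ₂)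
  LinearIntervalOfHeight k (P , Q) = LinearInterval (P , Q) × HasHeight P Q k

data Tree : Set where
  leaf : Tree
  node : Tree → Tree → Tree

size : Tree → ℕ
size leaf       = 0
size (node l r) = suc (size l + size r)

data _⟶_ : Tree → Tree → Set where
  rotate : ∀ {T U V} → node T (node U V) ⟶ node (node T U) V
  left   : ∀ {l l′ r} → l ⟶ l′ → node l r ⟶ node l′ r
  right  : ∀ {l r r′} → r ⟶ r′ → node l r ⟶ node l r′

_≤ᵀ_ : Tree → Tree → Set
_≤ᵀ_ = Star _⟶_

⟶-size : ∀ {s t} → s ⟶ t → size s ≡ size t
⟶-size (rotate {T} {U} {V}) = cong suc (eq (size T) (size U) (size V))
  where
  eq : ∀ b c d → b + suc (c + d) ≡ suc (b + c) + d
  eq = solve-∀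
⟶-size (left {r = r} p)  = cong (λ m → suc (m + size r)) (⟶-size p)
⟶-size (right {l = l} p) = cong (λ m → suc (size l + m)) (⟶-size p)

-- Strictly increased by every left rotation, whence antisymmetry.
weight : Tree → ℕ
weight leaf       = 0
weight (node l r) = size l + (weight l + weight r)

⟶-weight : ∀ {s t} → s ⟶ t → weight s < weight t
⟶-weight (rotate {T} {U} {V}) =
  subst (weight (node T (node U V)) <_)
        (sym (eq (size T) (size U) (weight T) (weight U) (weight V)))
        (s≤s (m≤m+n _ (size T)))
  where
  eq : ∀ b c x y z →
       suc (b + c) + ((b + (x + y)) + z) ≡ suc ((b + (x + (c + (y + z)))) + b)
  eq = solve-∀
⟶-weight (left {l} {l′} {r} p) rewrite ⟶-size p =
  +-monoʳ-< (size l′) (+-monoˡ-< (weight r) (⟶-weight p))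
⟶-weight (right {l} p) = +-monoʳ-< (size l) (+-monoʳ-< (weight l) (⟶-weight p))

≤ᵀ-weight : ∀ {s t} → s ≤ᵀ t → weight s ≤ weight t
≤ᵀ-weight ε       = ≤-refl
≤ᵀ-weight (p ◅ q) = ≤-trans (<⇒≤ (⟶-weight p)) (≤ᵀ-weight q)

≤ᵀ-antisym : ∀ {s t} → s ≤ᵀ t → t ≤ᵀ s → s ≡ t
≤ᵀ-antisym ε       _ = refl
≤ᵀ-antisym (p ◅ q) r =
  contradiction (<-≤-trans (⟶-weight p) (≤ᵀ-weight (q ◅◅ r))) (n≮n _)

rotationPoset : Poset 0ℓ 0ℓ 0ℓ
rotationPoset = record
  { Carrier        = Tree
  ; _≈_            = _≡_
  ; _≤_            = _≤ᵀ_
  ; isPartialOrder = record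
    { isPreorder = record
      { isEquivalence = isEquivalence
      ; reflexive     = λ { refl → ε }
      ; trans         = _◅◅_
      }
    ; antisym = ≤ᵀ-antisym
    }
  }

-- Restricting the order on all trees loses nothing, as rotations preserve
-- size (⟶-size).  Equality of elements is equality of the underlying trees.
Tam : ℕ → Poset 0ℓ 0ℓ 0ℓ
Tam n = On.poset rotationPoset (proj₁ {A = Tree} {B = λ t → size t ≡ n})

-- For a < 0 there is no b with 0 ≤ b ≤ a, and a C b = 0 for naturals b > a.
binom : ℤ → ℤ → ℕ
binom (+ a)      (+ b)      = a C b
binom (+ _)      (-[1+ _ ]) = 0
binom (-[1+ _ ]) _          = 0

absorption : ∀ n k → suc k * (suc n C suc k) ≡ suc n * (n C k)
absorption n       zero    =
  trans (*-identityˡ _) (trans (nC1≡n (suc n)) (sym (*-identityʳ (suc n))))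
absorption zero    (suc k) =
  trans (cong (suc (suc k) *_) (k>n⇒nCk≡0 {1} {suc (suc k)} (s≤s (s≤s z≤n))))
        (trans (*-zeroʳ (suc (suc k)))
               (sym (cong (1 *_) (k>n⇒nCk≡0 {0} {suc k} (s≤s z≤n)))))
absorption (suc n) (suc k) = begin
  suc (suc k) * (suc (suc n) C suc (suc k))
    ≡⟨ cong (suc (suc k) *_) (nCk+nC[k+1]≡[n+1]C[k+1] (suc n) (suc k)) ⟨
  suc (suc k) * (x + (suc n C suc (suc k)))
    ≡⟨ *-distribˡ-+ (suc (suc k)) x _ ⟩
  (x + suc k * x) + suc (suc k) * (suc n C suc (suc k))
    ≡⟨ cong₂ (λ u v → (x + u) + v) (absorption n k) (absorption n (suc k)) ⟩
  (x + suc n * (n C k)) + suc n * (n C suc k)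
    ≡⟨ +-assoc x _ _ ⟩
  x + (suc n * (n C k) + suc n * (n C suc k))
    ≡⟨ cong (λ u → x + u) (*-distribˡ-+ (suc n) (n C k) (n C suc k)) ⟨
  x + suc n * ((n C k) + (n C suc k))
    ≡⟨ cong (λ u → x + suc n * u) (nCk+nC[k+1]≡[n+1]C[k+1] n k) ⟩
  suc (suc n) * x ∎
  where
  open Relation.Binary.PropositionalEquality.≡-Reasoning
  x = suc n C suc k

-- So the division of this binomial coefficient by suc n in ℕ is exact.
suc-n∣2nCn : ∀ n → suc n ∣ binom (+ (2 * n)) (+ n)
suc-n∣2nCn n = ∣m+n∣m⇒∣n {suc n} {suc (2 * n) * c} {c}
  (subst (suc n ∣_) (eq n c) (m∣m*n (2 * c)))
  (subst (suc n ∣_) (absorption (2 * n) n) (m∣m*n (suc (2 * n) C suc n)))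
  where
  c = (2 * n) C n
  eq : ∀ n c → suc n * (2 * c) ≡ suc (2 * n) * c + c
  eq = solve-∀

{-# OPTIONS --safe #-}
module Submission where

open import Defs
open import Data.Integer.Base using (+_; _⊖_)
open import Data.Nat.Base using (ℕ; suc; _+_; _*_; _≤_; _<_; _/_)
open import Data.Product.Base using (_×_)
open import Relation.Nullary.Negation using (¬_)

open import Data.Empty using (⊥)
open import Data.Integer.Properties using (⊖-≥)
open import Data.List.Base using (List; []; _∷_; _++_; length; foldr; reverse)
open import Data.List.Membership.Propositional using (_∈_)
open import Data.List.Properties
  using (++-assoc; length-++; reverse-injective; foldr-∷ʳ; unfold-reverse)
import Data.List.Relation.Binary.Pointwise as Pw
open Pw using (Pointwise; []; _∷_)
open import Data.List.Relation.Unary.All as All using (All; []; _∷_)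
open import Data.List.Relation.Unary.All.Properties using (¬Any⇒All¬)
open import Data.List.Relation.Unary.AllPairs using ([]; _∷_)
open import Data.List.Relation.Unary.Any using (Any; here; there)
import Data.List.Relation.Unary.Any.Properties as Any
import Data.List.Relation.Unary.Unique.Setoid as Unique
import Data.List.Relation.Unary.Unique.Setoid.Properties as Uniqueₚ
open import Data.Nat.Base using (zero; _∸_; _≥_; s≤s; z≤n)
open import Data.Nat.Combinatorics
  using (_C_; nCk+nC[k+1]≡[n+1]C[k+1]; nCk≡nC[n∸k]; k>n⇒nCk≡0)
open import Data.Nat.DivMod using (m*n/n≡m)
open import Data.Nat.Properties
open import Data.Nat.Tactic.RingSolver using (solve-∀)
open import Data.Product.Base using (Σ; _,_; proj₁; proj₂; ∃-syntax)
open import Data.Sum.Base using (_⊎_; inj₁; inj₂)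
open import Data.Unit.Base using (⊤; tt)
open import Data.Vec.Base using (Vec; []; _∷_)
open import Function.Base using (_∘_; id)
open import Function.Bundles using (_⇔_; mk⇔; Equivalence)
open import Level using (Level; 0ℓ)
open import Relation.Binary.Bundles using (Setoid)
open import Relation.Binary.Construct.Closure.ReflexiveTransitive
  using (ε; _◅_; _◅◅_; gmap)
open import Relation.Binary.PropositionalEquality
open import Relation.Nullary.Negation using (contradiction)
open import Relation.Unary using (Pred)
open Equivalence using (to; from)

-- The linear intervals of positive height are classified up to a common
-- context, that is, a tree with a hole filled by both endpoints.  Such an
-- interval is either a slide
--
--   (B,((..((X,c_k),c_(k-1)),..),c_1))  to  ((..(((B,X),c_k),c_(k-1)),..),c_1),
--
-- in which successive rotations move down a left comb, or a lift
--
--   (a_k,(..,(a_2,(a_1,(Y,Z)))))  to  ((a_k,(..,(a_2,(a_1,Y)))),Z),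
--
-- in which successive rotations move up a right comb.  Each is given by its
-- context and k + 2 trees.  For k = 1 both describe a single rotation; for
-- k at least 2 no interval is both a slide and a lift.
--
-- Why these intervals are linear: listing the sizes of the right subtrees in
-- inorder gives a vector which rotations lower in exactly one coordinate, so
-- P ≤ Q implies that the vector of P dominates that of Q.  Along a slide or a
-- lift, a comparison of vectors shows that each tree has only one rotation
-- that stays below the top (pattern⇒thread).  Hence the interval consists of
-- that single chain (thread⇒linear, chain-bound).
--
-- Why there are no others: two distinct rotations of one tree are
-- incomparable (⟶-covers).  So in a linear interval each rotation is the only
-- one staying in the interval.  Consider a rotation followed by the first
-- rotation of a slide or a lift (before, prefix).  If the two do not continue
-- a slide or a lift, they either commute or run along a side of a pentagon,
-- and then there is a second rotation staying in the interval.  A lift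
-- followed by a slide runs along the long side of a pentagon, and a slide
-- followed by a lift cannot occur (extend).
--
-- Counting: the pairs of a context and r trees of total size m number
-- C(2m + r, m).  Splitting the first of r + 1 trees at its root, when it has
-- one, and the context at its innermost frame, when there are no trees, gives
-- Pascal's recurrence (count-pointed).  Endpoints of height k and size n use
-- r = k + 2 and m = n - k - 1, and they determine the data (plug-unique).
-- Splitting contexts off also expresses the number of plain forests through
-- these binomials, which yields the Catalan numbers (ballot-pointed,
-- catalan).  The sum over the heights k with 2 ≤ k < n is a hockey-stick sum
-- (count-height-≥).

-- The inorder vector of right-subtree sizes

-- The sizes of the right subtrees of the nodes, in inorder.
rightSizes : Tree → List ℕ
rightSizes leaf       = []
rightSizes (node l r) = rightSizes l ++ size r ∷ rightSizes r

-- Lists of equal length, the first dominating the second entrywise.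
_≽ˡ_ : List ℕ → List ℕ → Set
_≽ˡ_ = Pointwise _≥_

-- The vector of s dominates that of t; implied by s ≤ᵀ t.
_≽_ : Tree → Tree → Set
s ≽ t = rightSizes s ≽ˡ rightSizes t

length-rightSizes : ∀ t → length (rightSizes t) ≡ size t
length-rightSizes leaf       = refl
length-rightSizes (node l r) =
  trans (length-++ (rightSizes l))
        (trans (cong₂ (λ i j → i + suc j) (length-rightSizes l) (length-rightSizes r))
               (+-suc (size l) (size r)))

-- Compared with the vector of node T (node U V), only the entry of the rotated
-- node differs: it drops from suc (size U + size V) to size U.
rightSizes-rotate : ∀ T U V →
  rightSizes (node (node T U) V) ≡ rightSizes T ++ size U ∷ rightSizes (node U V)
rightSizes-rotate T U V = ++-assoc (rightSizes T) (size U ∷ rightSizes U) _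

-- Sizes of left subtrees align the two inorder listings, so domination can be
-- read off separately on left subtree, root and right subtree.
≽ˡ-split : ∀ as bs {x y cs ds} → length as ≡ length bs →
           (as ++ x ∷ cs) ≽ˡ (bs ++ y ∷ ds) → as ≽ˡ bs × x ≥ y × cs ≽ˡ ds
≽ˡ-split []       []       _  (x≥y ∷ p) = [] , x≥y , p
≽ˡ-split (_ ∷ as) (_ ∷ bs) eq (q ∷ p) with ≽ˡ-split as bs (suc-injective eq) p
... | l , m , r = q ∷ l , m , r

≽-split : ∀ s t {x y cs ds} → size s ≡ size t →
          (rightSizes s ++ x ∷ cs) ≽ˡ (rightSizes t ++ y ∷ ds) → s ≽ t × x ≥ y × cs ≽ˡ ds
≽-split s t eq =
  ≽ˡ-split (rightSizes s) (rightSizes t)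
    (trans (length-rightSizes s) (trans eq (sym (length-rightSizes t))))

-- The same when one side is node (node T U) V, whose inorder listing is cut at
-- the root of its left son rather than at its own root.
≽-split-rotateˡ : ∀ T {U V} t {y ds} → size T ≡ size t →
  rightSizes (node (node T U) V) ≽ˡ (rightSizes t ++ y ∷ ds) →
  T ≽ t × size U ≥ y × rightSizes (node U V) ≽ˡ ds
≽-split-rotateˡ T {U} {V} t eq q =
  ≽-split T t eq (subst (_≽ˡ _) (rightSizes-rotate T U V) q)

≽-split-rotateʳ : ∀ s T {U V} {x cs} → size s ≡ size T →
  (rightSizes s ++ x ∷ cs) ≽ˡ rightSizes (node (node T U) V) →
  s ≽ T × x ≥ size U × cs ≽ˡ rightSizes (node U V)
≽-split-rotateʳ s T {U} {V} eq q =
  ≽-split s T eq (subst (_ ≽ˡ_) (rightSizes-rotate T U V) q)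

≽ˡ-refl : ∀ {as} → as ≽ˡ as
≽ˡ-refl = Pw.refl ≤-refl

size-left< : ∀ U V → size U < size (node U V)
size-left< U V = s≤s (m≤m+n (size U) (size V))

⟶⇒≽ : ∀ {s t} → s ⟶ t → s ≽ t
⟶⇒≽ (rotate {T} {U} {V}) =
  subst (rightSizes (node T (node U V)) ≽ˡ_) (sym (rightSizes-rotate T U V))
    (Pw.++⁺ (≽ˡ-refl {rightSizes T}) (<⇒≤ (size-left< U V) ∷ ≽ˡ-refl))
⟶⇒≽ (left p)              = Pw.++⁺ (⟶⇒≽ p) ≽ˡ-refl
⟶⇒≽ (right {l} {r} {r′} p) =
  Pw.++⁺ (≽ˡ-refl {rightSizes l}) (≤-reflexive (sym (⟶-size p)) ∷ ⟶⇒≽ p)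

≤ᵀ⇒≽ : ∀ {s t} → s ≤ᵀ t → s ≽ t
≤ᵀ⇒≽ ε       = ≽ˡ-refl
≤ᵀ⇒≽ (p ◅ q) = Pw.transitive (λ a b → ≤-trans b a) (⟶⇒≽ p) (≤ᵀ⇒≽ q)

≤ᵀ-size : ∀ {s t} → s ≤ᵀ t → size s ≡ size t
≤ᵀ-size ε       = refl
≤ᵀ-size (p ◅ q) = trans (⟶-size p) (≤ᵀ-size q)

-- A rotation lowers one entry strictly.
⟶⇒⋡ : ∀ {s t} → s ⟶ t → ¬ (t ≽ s)
⟶⇒⋡ (rotate {T} {U} {V}) q
  with _ , r , _ ← ≽-split-rotateˡ T T refl q
  = <⇒≱ (size-left< U V) r
⟶⇒⋡ (left {l} {l′} p) q = ⟶⇒⋡ p (proj₁ (≽-split l′ l (sym (⟶-size p)) q))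
⟶⇒⋡ (right {l} p)     q = ⟶⇒⋡ p (proj₂ (proj₂ (≽-split l l refl q)))

⟶-irrefl : ∀ {t} → ¬ (t ⟶ t)
⟶-irrefl p = ⟶⇒⋡ p ≽ˡ-refl

-- Two rotations of one tree act at different nodes unless they are equal, and
-- each lowers only the entry of its own node; so distinct results are
-- incomparable.
⟶-covers : ∀ {P A B} → P ⟶ A → P ⟶ B → A ≽ B → A ≡ B
⟶-covers rotate rotate _ = refl
⟶-covers (rotate {T} {U} {V}) (left {l′ = l′} p) q
  with _ , r , _ ← ≽-split-rotateˡ T l′ (⟶-size p) q
  = contradiction r (<⇒≱ (size-left< U V))
⟶-covers (rotate {T} {U} {V}) (right p) q
  with _ , r , _ ← ≽-split-rotateˡ T T refl q
  = contradiction (subst (size U ≥_) (sym (⟶-size p)) r) (<⇒≱ (size-left< U V))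
⟶-covers (left {l′ = l′} p) (rotate {T}) q =
  contradiction (proj₁ (≽-split-rotateʳ l′ T (sym (⟶-size p)) q)) (⟶⇒⋡ p)
⟶-covers (right p) (rotate {T}) q =
  contradiction (proj₂ (proj₂ (≽-split-rotateʳ T T refl q))) (⟶⇒⋡ p)
⟶-covers (left {l′ = l′} p) (left {l′ = l″} {r} p′) q =
  cong (λ l → node l r)
    (⟶-covers p p′ (proj₁ (≽-split l′ l″ (trans (sym (⟶-size p)) (⟶-size p′)) q)))
⟶-covers (left {l} {l′} p) (right p′) q =
  contradiction (proj₁ (≽-split l′ l (sym (⟶-size p)) q)) (⟶⇒⋡ p)
⟶-covers (right {l} p) (left {l′ = l′} p′) q =
  contradiction (proj₂ (proj₂ (≽-split l l′ (⟶-size p′) q))) (⟶⇒⋡ p)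
⟶-covers (right {l} p) (right p′) q =
  cong (node l) (⟶-covers p p′ (proj₂ (proj₂ (≽-split l l refl q))))

-- Threads: chains forced at every step

-- P′ is the only rotation of P whose vector still dominates that of Q.
Forced : Tree → Tree → Tree → Set
Forced P P′ Q = ∀ {R} → P ⟶ R → R ≽ Q → R ≡ P′

-- A chain of k rotations from P to Q, each of them the only one whose result
-- still dominates Q.
infixr 5 _then_
data Thread : Tree → Tree → ℕ → Set where
  done : ∀ {P} → Thread P P 0
  _then_ : ∀ {P P′ Q k} → P ⟶ P′ × Forced P P′ Q → Thread P′ Q k → Thread P Q (suc k)

thread⇒≤ᵀ : ∀ {P Q k} → Thread P Q k → P ≤ᵀ Q
thread⇒≤ᵀ done             = ε
thread⇒≤ᵀ ((p , _) then t) = p ◅ thread⇒≤ᵀ t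

forced-left : ∀ {P P′ Q} r → size P ≡ size Q →
              Forced P P′ Q → Forced (node P r) (node P′ r) (node Q r)
forced-left {P} {_} {Q} _ eq h (rotate {U = U} {V}) q
  with _ , x , _ ← ≽-split-rotateˡ P Q eq q
  = contradiction x (<⇒≱ (size-left< U V))
forced-left {Q = Q} r eq h (left {l′ = l′} p) q =
  cong (λ l → node l r) (h p (proj₁ (≽-split l′ Q (trans (sym (⟶-size p)) eq) q)))
forced-left {P} {_} {Q} _ eq h (right p) q =
  contradiction (proj₂ (proj₂ (≽-split P Q eq q))) (⟶⇒⋡ p)

forced-right : ∀ {P P′ Q} l → size P ≡ size Q →
               Forced P P′ Q → Forced (node l P) (node l P′) (node l Q)
forced-right l eq h (rotate {U = U} {V}) q
  with _ , x , _ ← ≽-split-rotateˡ l l refl q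
  = contradiction (subst (size U ≥_) (sym eq) x) (<⇒≱ (size-left< U V))
forced-right l eq h (left {l′ = l′} p) q =
  contradiction (proj₁ (≽-split l′ l (sym (⟶-size p)) q)) (⟶⇒⋡ p)
forced-right l eq h (right p) q = cong (node l) (h p (proj₂ (proj₂ (≽-split l l refl q))))

thread-size : ∀ {P Q k} → Thread P Q k → size P ≡ size Q
thread-size t = ≤ᵀ-size (thread⇒≤ᵀ t)

thread-left : ∀ {P Q k} r → Thread P Q k → Thread (node P r) (node Q r) k
thread-left r done = done
thread-left r t@((p , h) then u) =
  (left p , forced-left r (thread-size t) h) then thread-left r u

thread-right : ∀ {P Q k} l → Thread P Q k → Thread (node l P) (node l Q) k
thread-right l done = done
thread-right l t@((p , h) then u) =
  (right p , forced-right l (thread-size t) h) then thread-right l u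

-- The root rotation of node B (node Y Z) lowers the entry of the root only;
-- any other rotation lowers an entry inside B or inside node Y Z, where the
-- vector of Q agrees with that of the initial tree.
forced-rotate : ∀ {B Y Z x} Q → rightSizes Q ≡ rightSizes B ++ x ∷ rightSizes (node Y Z) →
                Forced (node B (node Y Z)) (node (node B Y) Z) Q
forced-rotate Q eq rotate q = refl
forced-rotate {B} Q eq (left {l′ = l′} p) q =
  contradiction (proj₁ (≽-split l′ B (sym (⟶-size p)) (subst (_ ≽ˡ_) eq q))) (⟶⇒⋡ p)
forced-rotate {B} Q eq (right p) q =
  contradiction (proj₂ (proj₂ (≽-split B B refl (subst (_ ≽ˡ_) eq q)))) (⟶⇒⋡ p)

-- With the size hypothesis, the root rotation of node b (node T₁ T₂) lowers
-- the root entry to size T₁, below its final value size S.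
forced-lift : ∀ {T₁ T₂ T′ S Z} b → size T₁ < size S → Forced (node T₁ T₂) T′ (node S Z) →
              Forced (node b (node T₁ T₂)) (node b T′) (node (node b S) Z)
forced-lift {T₁} {T₂} {S = S} {Z} b lt h rotate q
  with _ , x , _ ← ≽-split-rotateˡ b b refl (subst (_ ≽ˡ_) (rightSizes-rotate b S Z) q)
  = contradiction x (<⇒≱ lt)
forced-lift b lt h (left {l′ = l′} p) q =
  contradiction (proj₁ (≽-split-rotateʳ l′ b (sym (⟶-size p)) q)) (⟶⇒⋡ p)
forced-lift b lt h (right p) q =
  cong (node b) (h p (proj₂ (proj₂ (≽-split-rotateʳ b b refl q))))

-- Slides and lifts

-- Hangs T at the end of a left comb whose right subtrees are listed from the
-- root downwards.
leftComb : ∀ {k} → Vec Tree k → Tree → Tree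
leftComb []       T = T
leftComb (c ∷ cs) T = node (leftComb cs T) c

-- Hangs T at the end of a right comb whose left subtrees are listed from the
-- innermost outwards.
rightComb : ∀ {k} → Vec Tree k → Tree → Tree
rightComb []       T = T
rightComb (a ∷ as) T = rightComb as (node a T)

-- The endpoints of slides and lifts of height k.
slideBottom slideTop liftBottom liftTop : ∀ {k} → Vec Tree (2 + k) → Tree
slideBottom (B ∷ X ∷ cs) = node B (leftComb cs X)
slideTop    (B ∷ X ∷ cs) = leftComb cs (node B X)
liftBottom  (Y ∷ Z ∷ as) = rightComb as (node Y Z)
liftTop     (Y ∷ Z ∷ as) = node (rightComb as Y) Z

rightSizes-slideTop : ∀ {k} B X (cs : Vec Tree k) →
  rightSizes (leftComb cs (node B X)) ≡ rightSizes B ++ size X ∷ rightSizes (leftComb cs X)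
rightSizes-slideTop B X []       = refl
rightSizes-slideTop B X (c ∷ cs) =
  trans (cong (_++ size c ∷ rightSizes c) (rightSizes-slideTop B X cs))
        (++-assoc (rightSizes B) (size X ∷ rightSizes (leftComb cs X)) _)

slide-thread : ∀ {k} (ts : Vec Tree (2 + k)) → Thread (slideBottom ts) (slideTop ts) k
slide-thread (B ∷ X ∷ [])     = done
slide-thread (B ∷ X ∷ c ∷ cs) =
  (rotate , forced-rotate (slideTop (B ∷ X ∷ c ∷ cs)) (rightSizes-slideTop B X (c ∷ cs)))
  then thread-left c (slide-thread (B ∷ X ∷ cs))

rightComb-⟶ : ∀ {k} (as : Vec Tree k) {S T} → S ⟶ T → rightComb as S ⟶ rightComb as T
rightComb-⟶ []       p = p
rightComb-⟶ (a ∷ as) p = rightComb-⟶ as (right p)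

forced-rightComb : ∀ {k} (as : Vec Tree k) {T₁ T₂ T′ S Z} → size T₁ < size S →
  Forced (node T₁ T₂) T′ (node S Z) →
  Forced (rightComb as (node T₁ T₂)) (rightComb as T′) (node (rightComb as S) Z)
forced-rightComb []       lt h = h
forced-rightComb (a ∷ as) {S = S} lt h = forced-rightComb as (size-left< a S) (forced-lift a lt h)

lift-thread : ∀ {k} (ts : Vec Tree (2 + k)) → Thread (liftBottom ts) (liftTop ts) k
lift-thread (Y ∷ Z ∷ [])     = done
lift-thread (Y ∷ Z ∷ a ∷ as) =
  ( rightComb-⟶ as rotate
  , forced-rightComb as (size-left< a Y)
      (forced-rotate (node (node a Y) Z) (rightSizes-rotate a Y Z)) )
  then lift-thread (node a Y ∷ Z ∷ as)

-- Contexts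

-- One step of a path to a hole: in r ◁ the hole is the left son, next to the
-- right son r; in ▷ l it is the right son, next to the left son l.
data Frame : Set where
  _◁ ▷_ : Tree → Frame

-- A tree with a hole, as the list of frames from the hole to the root.
Context : Set
Context = List Frame

plug : Context → Tree → Tree
plug []           T = T
plug ((r ◁) ∷ c)  T = plug c (node T r)
plug ((▷ l) ∷ c)  T = plug c (node l T)

plug-thread : ∀ c {P Q k} → Thread P Q k → Thread (plug c P) (plug c Q) k
plug-thread []          t = t
plug-thread ((r ◁) ∷ c) t = plug-thread c (thread-left r t)
plug-thread ((▷ l) ∷ c) t = plug-thread c (thread-right l t)

plug-⟶ : ∀ c {S T} → S ⟶ T → plug c S ⟶ plug c T
plug-⟶ []          p = p
plug-⟶ ((r ◁) ∷ c) p = plug-⟶ c (left p)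
plug-⟶ ((▷ l) ∷ c) p = plug-⟶ c (right p)

plug-≤ᵀ : ∀ c {S T} → S ≤ᵀ T → plug c S ≤ᵀ plug c T
plug-≤ᵀ c = gmap (plug c) (plug-⟶ c)

node-injective : ∀ {l r l′ r′} → node l r ≡ node l′ r′ → l ≡ l′ × r ≡ r′
node-injective refl = refl , refl

plug-injective : ∀ c {S T} → plug c S ≡ plug c T → S ≡ T
plug-injective []          eq = eq
plug-injective ((r ◁) ∷ c) eq = proj₁ (node-injective (plug-injective c eq))
plug-injective ((▷ l) ∷ c) eq = proj₂ (node-injective (plug-injective c eq))

-- The classified intervals, by height.  For height 1 slides and lifts coincide,
-- so lifts start at height 2.
data Pattern : ℕ → Tree → Tree → Set where
  trivial : ∀ {P} → Pattern 0 P P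
  slide   : ∀ {k} c (ts : Vec Tree (3 + k)) →
            Pattern (1 + k) (plug c (slideBottom ts)) (plug c (slideTop ts))
  lift    : ∀ {k} c (ts : Vec Tree (4 + k)) →
            Pattern (2 + k) (plug c (liftBottom ts)) (plug c (liftTop ts))

pattern⇒thread : ∀ {k P Q} → Pattern k P Q → Thread P Q k
pattern⇒thread trivial      = done
pattern⇒thread (slide c ts) = plug-thread c (slide-thread ts)
pattern⇒thread (lift c ts)  = plug-thread c (lift-thread ts)

-- Rotations leading to a given tree

node≢leftˡ : ∀ {T U} → T ≢ node T U
node≢leftˡ {T} {U} eq = <⇒≢ (size-left< T U) (cong size eq)

-- Before c Y P describes a rotation P ⟶ plug c Y relative to the subtree Y:
-- it takes place inside Y, or outside, moving the context from d to c whatever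
-- tree fills the hole, or Y is the left son that the rotation created.  The
-- inequality kept in the outside case separates the results of rotating P in
-- the context and of rotating it inside Y.
data Before : Context → Tree → Tree → Set where
  inside  : ∀ {c Y₀ Y} → Y₀ ⟶ Y → Before c Y (plug c Y₀)
  outside : ∀ {c Y} d → (∀ Z → plug d Z ⟶ plug c Z) →
            (∀ {Z Z′} → size Z ≡ size Z′ → plug d Z′ ≢ plug c Z) → Before c Y (plug d Y)
  above   : ∀ {c r T U} → Before ((r ◁) ∷ c) (node T U) (plug c (node T (node U r)))

before : ∀ c {Y P} → P ⟶ plug c Y → Before c Y P
before [] p = inside p
before ((r ◁) ∷ c) p with before c p
... | inside rotate = above
... | inside (left q) = inside q
... | inside (right {r = r₀} q) =
  outside ((r₀ ◁) ∷ c) (λ Z → plug-⟶ c (right q))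
    (λ _ eq → ⟶-irrefl (subst (_⟶ r) (proj₂ (node-injective (plug-injective c eq))) q))
... | outside d q ne =
  outside ((r ◁) ∷ d) (λ Z → q (node Z r)) (λ eq → ne (cong (λ i → suc (i + size r)) eq))
... | above {c′} {s} =
  outside ((node r s ◁) ∷ c′) (λ Z → plug-⟶ c′ rotate)
    (λ {Z} eq eq′ → <⇒≢ (size-left< Z r)
      (trans eq (cong size (proj₁ (node-injective (plug-injective c′ eq′))))))
before ((▷ l) ∷ c) p with before c p
... | inside (rotate {T} {U}) =
  outside ((▷ U) ∷ (▷ T) ∷ c) (λ Z → plug-⟶ c rotate)
    (λ _ eq → node≢leftˡ (proj₁ (node-injective (plug-injective c eq))))
... | inside (left {l = l₀} q) =
  outside ((▷ l₀) ∷ c) (λ Z → plug-⟶ c (left q))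
    (λ _ eq → ⟶-irrefl (subst (_⟶ l) (proj₁ (node-injective (plug-injective c eq))) q))
... | inside (right q) = inside q
... | outside d q ne =
  outside ((▷ l) ∷ d) (λ Z → q (node l Z)) (λ eq → ne (cong (λ i → suc (size l + i)) eq))
... | above {c′} {s} =
  outside ((s ◁) ∷ (▷ l) ∷ c′) (λ Z → plug-⟶ c′ rotate)
    (λ _ eq → node≢leftˡ (proj₁ (node-injective (plug-injective c′ eq))))

-- P₁ is the only rotation of P that stays below Q.
Forcedᵀ : Tree → Tree → Tree → Set
Forcedᵀ P P₁ Q = ∀ {R} → P ⟶ R → R ≤ᵀ Q → R ≡ P₁

-- The rotations P ⟶ plug c (node B (node Y Z)) that may precede the rotation
-- of node B (node Y Z) inside a linear interval: the second rotation happens at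
-- the left son of the node of the first, or at its parent.
data Prefix : Context → Tree → Tree → Tree → Tree → Set where
  sliding : ∀ {c r B Y Z} → Prefix ((r ◁) ∷ c) B Y Z (plug c (node B (node (node Y Z) r)))
  lifting : ∀ {c B Y Z} T U → Y ≡ node T U → Prefix c B Y Z (plug c (node B (node T (node U Z))))

plug-rotated≢ : ∀ c {B Y Z B₀ W} → size B ≡ size B₀ →
                plug c (node (node B₀ Y) Z) ≢ plug c (node B W)
plug-rotated≢ c {Y = Y} {B₀ = B₀} eq eq′ =
  <⇒≢ (size-left< B₀ Y)
      (trans (sym eq) (sym (cong size (proj₁ (node-injective (plug-injective c eq′))))))

-- In every other case, performing the two rotations in another order gives
-- another path from P to the same tree.
prefix : ∀ c {B Y Z P} → P ⟶ plug c (node B (node Y Z)) →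
         Forcedᵀ P (plug c (node B (node Y Z))) (plug c (node (node B Y) Z)) →
         Prefix c B Y Z P
prefix c {B} {Y} {Z} p h with before c p
... | outside d q ne =
  contradiction (h (plug-⟶ d rotate) (q _ ◅ ε))
                (ne (⟶-size (rotate {B} {Y} {Z})))
... | above = sliding
... | inside (rotate {T}) =
  contradiction (h (plug-⟶ c (right rotate)) (plug-⟶ c rotate ◅ plug-⟶ c (left rotate) ◅ ε))
                (λ eq → node≢leftˡ (proj₁ (node-injective (plug-injective c eq))))
... | inside (left q) =
  contradiction (h (plug-⟶ c rotate) (plug-⟶ c (left (left q)) ◅ ε))
                (plug-rotated≢ c (sym (⟶-size q)))
... | inside (right (rotate {T} {U})) = lifting T U refl
... | inside (right (left q)) =
  contradiction (h (plug-⟶ c rotate) (plug-⟶ c (left (right q)) ◅ ε)) (plug-rotated≢ c refl)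
... | inside (right (right q)) =
  contradiction (h (plug-⟶ c rotate) (plug-⟶ c (right q) ◅ ε)) (plug-rotated≢ c refl)

-- Any single rotation is a slide of height 1.
rotation⇒pattern : ∀ {P Q} → P ⟶ Q → ∀ d → Pattern 1 (plug d P) (plug d Q)
rotation⇒pattern (rotate {T} {U} {V}) d = slide d (T ∷ U ∷ V ∷ [])
rotation⇒pattern (left {r = r} p)     d = rotation⇒pattern p ((r ◁) ∷ d)
rotation⇒pattern (right {l} p)        d = rotation⇒pattern p ((▷ l) ∷ d)

-- The frames along a right comb, followed by those of the context c.
rights : ∀ {k} → Vec Tree k → Context → Context
rights []       c = c
rights (a ∷ as) c = (▷ a) ∷ rights as c

plug-rights : ∀ {k} (as : Vec Tree k) c T → plug (rights as c) T ≡ plug c (rightComb as T)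
plug-rights []       c T = refl
plug-rights (a ∷ as) c T = plug-rights as c (node a T)

forcedᵀ-≤ᵀ : ∀ {P P₁ Q Q′} → Q ≤ᵀ Q′ → Forcedᵀ P P₁ Q′ → Forcedᵀ P P₁ Q
forcedᵀ-≤ᵀ le h p q = h p (q ◅◅ le)

-- A forced rotation into the bottom of a classified interval extends it to a
-- classified interval.
extend : ∀ {k P P₁ Q} → P ⟶ P₁ → Forcedᵀ P P₁ Q → Pattern k P₁ Q → Pattern (suc k) P Q
extend p h trivial = rotation⇒pattern p []
extend p h (slide c (B ∷ X ∷ Z ∷ cs))
  with prefix c p
         (forcedᵀ-≤ᵀ (plug-≤ᵀ c (thread⇒≤ᵀ (thread-left Z (slide-thread (B ∷ X ∷ cs))))) h)
... | sliding {c′} {r} = slide c′ (B ∷ X ∷ r ∷ Z ∷ cs)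
... | lifting T U eq with cs | eq
...   | []     | refl = lift c (U ∷ Z ∷ T ∷ B ∷ [])
-- The first two rotations form a lift, the second and third a slide.  Together
-- they form the long side of a pentagon, whose short side starts with the
-- rotation of the subtree in the hole at its root.
...   | d ∷ cs′ | refl =
  contradiction
    (h (plug-⟶ c rotate)
       (plug-⟶ c rotate ◅
        plug-≤ᵀ c (thread⇒≤ᵀ (thread-left Z (thread-left d (slide-thread (B ∷ X ∷ cs′)))))))
    (plug-rotated≢ c refl)
extend {P = P} p h (lift c (Y ∷ Z ∷ a ∷ b ∷ as))
  with prefix (rights (b ∷ as) c)
         (subst (P ⟶_) (sym (plug-rights (b ∷ as) c _)) p)
         (subst₂ (Forcedᵀ P) (sym (plug-rights (b ∷ as) c _)) (sym (plug-rights (b ∷ as) c _))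
           (forcedᵀ-≤ᵀ (plug-≤ᵀ c (thread⇒≤ᵀ (lift-thread (node a Y ∷ Z ∷ b ∷ as)))) h))
-- The sliding case is impossible, since the hole of rights (b ∷ as) c is a
-- right son.
... | lifting T U refl =
  subst (λ S → Pattern _ S (plug c (liftTop ts))) (sym (plug-rights (b ∷ as) c _)) (lift c ts)
  where ts = U ∷ Z ∷ T ∷ a ∷ b ∷ as

-- Linear intervals are the classified ones

-- Linearity of the interval in the order on all trees; rotations preserve size,
-- so it agrees with linearity within trees of one size.
LinearTree : Tree → Tree → Set
LinearTree P Q = ∀ {R S} → P ≤ᵀ R → R ≤ᵀ Q → P ≤ᵀ S → S ≤ᵀ Q → R ≤ᵀ S ⊎ S ≤ᵀ R

linear⇒forcedᵀ : ∀ {P P₁ Q} → LinearTree P Q → P ⟶ P₁ → P₁ ≤ᵀ Q → Forcedᵀ P P₁ Q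
linear⇒forcedᵀ lin p le {R} q le′ with lin (p ◅ ε) le (q ◅ ε) le′
... | inj₁ x = sym (⟶-covers p q (≤ᵀ⇒≽ x))
... | inj₂ x = ⟶-covers q p (≤ᵀ⇒≽ x)

linear⇒pattern : ∀ {P Q} → P ≤ᵀ Q → LinearTree P Q → ∃[ k ] Pattern k P Q
linear⇒pattern ε        lin = 0 , trivial
linear⇒pattern (p ◅ le) lin
  with k , pat ← linear⇒pattern le (λ a b c d → lin (p ◅ a) b (p ◅ c) d)
  = suc k , extend p (linear⇒forcedᵀ lin p le) pat

-- In a thread, every element of the interval other than the bottom lies above
-- the first step.
thread-split : ∀ {P P₁ Q R} → Forced P P₁ Q → P ≤ᵀ R → R ≤ᵀ Q → P ≡ R ⊎ P₁ ≤ᵀ R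
thread-split h ε        le = inj₁ refl
thread-split h (q ◅ le′) le with refl ← h q (≤ᵀ⇒≽ (le′ ◅◅ le)) = inj₂ le′

thread⇒linear : ∀ {P Q k} → Thread P Q k → LinearTree P Q
thread⇒linear done {R} {S} a b c d
  rewrite ≤ᵀ-antisym b a = inj₁ c
thread⇒linear ((p , h) then t) a b c d with thread-split h a b | thread-split h c d
... | inj₁ refl | _         = inj₁ c
... | inj₂ _    | inj₁ refl = inj₂ a
... | inj₂ a′   | inj₂ c′   = thread⇒linear t a′ b c′ d

module _ {n : ℕ} where

  open Intervals (Tam n)

  linearTree : ∀ {P Q} → IsLinear P Q → LinearTree (proj₁ P) (proj₁ Q)
  linearTree {_ , eq} lin a b c d =
    lin {_ , trans (sym (≤ᵀ-size a)) eq} {_ , trans (sym (≤ᵀ-size c)) eq} (a , b) (c , d)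

  thread⇒chain : ∀ {P Q k} → Thread P Q k → ∀ p q → Chain (P , p) (Q , q) k
  thread⇒chain done p q = stop refl
  thread⇒chain (_then_ {P′ = P′} (x , _) t) p q =
    step {R = P′ , trans (sym (⟶-size x)) p}
      ((x ◅ ε) , λ { refl → ⟶-irrefl x }) (thread⇒chain t _ q)

  chain⇒≤ᵀ : ∀ {P Q j} → Chain P Q j → proj₁ P ≤ᵀ proj₁ Q
  chain⇒≤ᵀ (stop refl)         = ε
  chain⇒≤ᵀ (step (le , _) ch) = le ◅◅ chain⇒≤ᵀ ch

  -- Chains within the interval are no longer than the thread.
  chain-bound : ∀ {P Q k} → Thread P Q k → ∀ {R S j} → proj₁ S ≡ Q →
                P ≤ᵀ proj₁ R → Chain R S j → j ≤ k
  chain-bound t eq le (stop _) = z≤n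
  chain-bound done refl le (step (le′ , ne) ch) =
    contradiction (≤ᵀ-antisym le′ (chain⇒≤ᵀ ch ◅◅ le)) ne
  chain-bound ((p , h) then t) refl le ch₀@(step (le′ , ne) ch)
    with thread-split h le (chain⇒≤ᵀ ch₀)
  ... | inj₂ le₁ = ≤-trans (chain-bound t refl le₁ ch₀) (n≤1+n _)
  ... | inj₁ refl with thread-split h le′ (chain⇒≤ᵀ ch)
  ...   | inj₁ eq  = contradiction eq ne
  ...   | inj₂ le₂ = s≤s (chain-bound t refl le₂ ch)

  pattern⇒interval : ∀ {k P Q} → Pattern k (proj₁ P) (proj₁ Q) → LinearIntervalOfHeight k (P , Q)
  pattern⇒interval {P = P} {Q} pat =
    (thread⇒≤ᵀ t , λ { (a , b) (c , d) → thread⇒linear t a b c d })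
    , thread⇒chain t _ _ , chain-bound t refl ε
    where t = pattern⇒thread pat

  interval⇒pattern : ∀ {k P Q} → LinearIntervalOfHeight k (P , Q) → Pattern k (proj₁ P) (proj₁ Q)
  interval⇒pattern {k} {P} {Q} ((le , lin) , ch , mx)
    with j , pat ← linear⇒pattern le (linearTree {P} {Q} (λ {R} {S} → lin {R} {S})) =
    subst (λ i → Pattern i (proj₁ P) (proj₁ Q))
      (≤-antisym (mx (thread⇒chain (pattern⇒thread pat) _ _))
                 (chain-bound (pattern⇒thread pat) refl ε ch)) pat

-- Rules for counting

private variable
  a ℓ p q r : Level

-- Counting up to propositional equality.
Counts : {A : Set a} → Pred A p → ℕ → Set _
Counts {A = A} = HasCount (setoid A)

count-⇔ : (S : Setoid a ℓ) {P : Pred (Setoid.Carrier S) p} {Q : Pred (Setoid.Carrier S) q}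
          {m : ℕ} →
          (∀ x → P x ⇔ Q x) → HasCount S P m → HasCount S Q m
count-⇔ S e (xs , len , uniq , mem) =
  xs , len , uniq , λ x → mk⇔ (to (e x) ∘ to (mem x)) (from (mem x) ∘ from (e x))

count-≡ : (S : Setoid a ℓ) {P : Pred (Setoid.Carrier S) p} {m n : ℕ} →
          m ≡ n → HasCount S P m → HasCount S P n
count-≡ S {P} = subst (HasCount S P)

count-none : (S : Setoid a ℓ) {P : Pred (Setoid.Carrier S) p} → (∀ x → ¬ P x) → HasCount S P 0
count-none S none = [] , refl , [] , λ x → mk⇔ (λ ()) (λ px → contradiction px (none x))

count-⊎ : (S : Setoid a ℓ) {P : Pred (Setoid.Carrier S) p} {Q : Pred (Setoid.Carrier S) q}
          {m n : ℕ} → (∀ x → P x → ¬ Q x) →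
          HasCount S P m → HasCount S Q n → HasCount S (λ x → P x ⊎ Q x) (m + n)
count-⊎ S disj (xs , refl , ux , mx) (ys , refl , uy , my) =
  xs ++ ys , length-++ xs ,
  Uniqueₚ.++⁺ S ux uy (λ {v} (i , j) → disj v (to (mx v) i) (to (my v) j)) ,
  λ x → mk⇔ (λ i → split x (Any.++⁻ xs i)) (join x)
  where
  split : ∀ x → _ → _
  split x (inj₁ i) = inj₁ (to (mx x) i)
  split x (inj₂ j) = inj₂ (to (my x) j)
  join : ∀ x → _ → _
  join x (inj₁ i) = Any.++⁺ˡ (from (mx x) i)
  join x (inj₂ j) = Any.++⁺ʳ xs (from (my x) j)

-- The image of a counted predicate P under an injection f that may use the
-- proof of P but does not depend on it up to equality.
module _ {A : Set a} {P : Pred A p} (S : Setoid r ℓ)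
         (f : ∀ x → P x → Setoid.Carrier S)
         (f-irr : ∀ {x} (u v : P x) → Setoid._≈_ S (f x u) (f x v))
         (f-inj : ∀ {x y} (u : P x) (v : P y) → Setoid._≈_ S (f x u) (f y v) → x ≡ y) where

  open Setoid S using (_≈_; Carrier)

  private
    length-reduce : ∀ {xs} (ps : All P xs) → length (All.reduce (f _) ps) ≡ length xs
    length-reduce []       = refl
    length-reduce (_ ∷ ps) = cong suc (length-reduce ps)

    reduce⁻ : ∀ {xs y} (ps : All P xs) → Any (y ≈_) (All.reduce (f _) ps) →
              ∃[ x ] Σ (P x) λ u → x ∈ xs × y ≈ f x u
    reduce⁻ (u ∷ ps) (here e)  = _ , u , here refl , e
    reduce⁻ (u ∷ ps) (there i) with x , v , j , e ← reduce⁻ ps i = x , v , there j , e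

    reduce⁺ : ∀ {xs x y} (ps : All P xs) (u : P x) → x ∈ xs → y ≈ f x u →
              Any (y ≈_) (All.reduce (f _) ps)
    reduce⁺ (v ∷ ps) u (here refl) e = here (Setoid.trans S e (f-irr u v))
    reduce⁺ (v ∷ ps) u (there i)   e = there (reduce⁺ ps u i e)

    unique-reduce : ∀ {xs} (ps : All P xs) → Unique.Unique (setoid A) xs →
                    Unique.Unique S (All.reduce (f _) ps)
    unique-reduce []       []        = []
    unique-reduce (u ∷ ps) (ne ∷ un) =
      ¬Any⇒All¬ _ (λ i → let _ , v , j , e = reduce⁻ ps i in All.lookup ne j (f-inj u v e))
      ∷ unique-reduce ps un

  count-image : ∀ {Q : Pred Carrier q} {m} →
                (∀ y → Q y ⇔ (∃[ x ] Σ (P x) λ u → y ≈ f x u)) →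
                Counts P m → HasCount S Q m
  count-image e (xs , refl , uniq , mem) =
    All.reduce (f _) ps , length-reduce ps , unique-reduce ps uniq ,
    λ y → mk⇔ (λ i → let x , u , _ , e′ = reduce⁻ ps i in from (e y) (x , u , e′))
              (λ qy → let x , u , e′ = to (e y) qy in reduce⁺ ps u (from (mem x) u) e′)
    where
    ps : All P xs
    ps = All.tabulate (λ {x} → to (mem x))

-- The image of a predicate under a function.
Image : {A B : Set} → (A → B) → Pred A 0ℓ → Pred B 0ℓ
Image f P y = ∃[ x ] P x × y ≡ f x

count-map : {A B : Set} {P : Pred A 0ℓ} {m : ℕ} (f : A → B) →
            (∀ {x y} → f x ≡ f y → x ≡ y) → Counts P m → Counts (Image f P) m
count-map {B = B} f inj =
  count-image (setoid B) (λ x _ → f x) (λ _ _ → refl) (λ _ _ → inj) (λ _ → mk⇔ id id)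

-- Counting forests with an extra datum

forestSize : ∀ {r} → Vec Tree r → ℕ
forestSize []       = 0
forestSize (t ∷ ts) = size t + forestSize ts

-- Pairs of a datum b of weight σ b and a forest of r trees.
module Forests {B : Set} (σ : B → ℕ) where

  -- Pairs of total weight m.
  Weighs : ∀ r → ℕ → Pred (B × Vec Tree r) 0ℓ
  Weighs r m (b , ts) = forestSize ts + σ b ≡ m

  private
    -- Puts a leaf in front of the forest.
    addLeaf : ∀ {r} → B × Vec Tree r → B × Vec Tree (suc r)
    addLeaf (b , ts) = b , leaf ∷ ts

    addLeaf-injective : ∀ {r} {x y : B × Vec Tree r} → addLeaf x ≡ addLeaf y → x ≡ y
    addLeaf-injective refl = refl

    -- Joins the first two trees at a new node.
    graft : ∀ {r} → B × Vec Tree (2 + r) → B × Vec Tree (suc r)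
    graft (b , s ∷ t ∷ ts) = b , node s t ∷ ts

    graft-injective : ∀ {r} {x y : B × Vec Tree (2 + r)} → graft x ≡ graft y → x ≡ y
    graft-injective {x = _ , _ ∷ _ ∷ _} {_ , _ ∷ _ ∷ _} refl = refl

  count-weight-zero : ∀ {r m} → Counts (Weighs r 0) m → Counts (Weighs (suc r) 0) m
  count-weight-zero {r} = count-⇔ (setoid _) eq ∘ count-map addLeaf addLeaf-injective
    where
    eq : ∀ y → Image addLeaf (Weighs r 0) y ⇔ Weighs (suc r) 0 y
    eq (b , leaf ∷ ts) = mk⇔ (λ { (_ , w , refl) → w }) (λ w → _ , w , refl)
    eq (b , node s t ∷ ts) = mk⇔ (λ { (_ , _ , ()) }) (λ ())

  -- The first tree is either a leaf, which is dropped, or a node, which is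
  -- replaced by its two sons.
  count-weight-suc : ∀ {r m i j} → Counts (Weighs r (suc m)) i → Counts (Weighs (2 + r) m) j →
                     Counts (Weighs (suc r) (suc m)) (i + j)
  count-weight-suc {r} {m} ci cj =
    count-⇔ (setoid _) eq
      (count-⊎ (setoid _) (λ { _ (_ , _ , refl) ((_ , _ ∷ _ ∷ _) , _ , ()) })
        (count-map addLeaf addLeaf-injective ci) (count-map graft graft-injective cj))
    where
    assoc : ∀ s t (ts : Vec Tree r) b →
      size s + (size t + forestSize ts) + σ b ≡ size s + size t + forestSize ts + σ b
    assoc s t ts b = cong (_+ σ b) (sym (+-assoc (size s) (size t) (forestSize ts)))
    eq : ∀ y → (Image addLeaf (Weighs r (suc m)) y ⊎ Image graft (Weighs (2 + r) m) y)
             ⇔ Weighs (suc r) (suc m) y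
    eq (b , leaf ∷ ts) =
      mk⇔ (λ { (inj₁ (_ , w , refl)) → w ; (inj₂ ((_ , _ ∷ _ ∷ _) , _ , ())) })
          (λ w → inj₁ (_ , w , refl))
    eq (b , node s t ∷ ts) =
      mk⇔ (λ { (inj₁ (_ , _ , ())) ; (inj₂ ((_ , _ ∷ _ ∷ _) , w , refl)) →
                 cong suc (trans (sym (assoc s t ts b)) w) })
          (λ w → inj₂ (_ , trans (assoc s t ts b) (suc-injective w) , refl))

-- The number of nodes of a context.
contextSize : Context → ℕ
contextSize []           = 0
contextSize ((t ◁) ∷ c) = suc (size t + contextSize c)
contextSize ((▷ t) ∷ c) = suc (size t + contextSize c)

module Pointed = Forests contextSize
module Plain   = Forests {⊤} (λ _ → 0)

-- The number of pairs of a context and r trees of total size m.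
pointed : ℕ → ℕ → ℕ
pointed m r = (r + (m + m)) C m

shift : ∀ m r → r + (suc m + suc m) ≡ suc (suc (r + (m + m)))
shift = solve-∀

pointed-suc : ∀ m r → pointed (suc m) r + pointed m (2 + r) ≡ pointed (suc m) (suc r)
pointed-suc m r = begin
  N C suc m + suc (suc (r + (m + m))) C m ≡⟨ cong (λ i → N C suc m + i C m) (shift m r) ⟨
  N C suc m + N C m                       ≡⟨ +-comm (N C suc m) _ ⟩
  N C m + N C suc m                       ≡⟨ nCk+nC[k+1]≡[n+1]C[k+1] N m ⟩
  suc N C suc m                           ∎
  where
  open ≡-Reasoning
  N = r + (suc m + suc m)

-- The symmetry of binomial coefficients, free of subtraction.
C-symmetric : ∀ i j → (i + j) C i ≡ (i + j) C j
C-symmetric i j = trans (nCk≡nC[n∸k] (m≤m+n i j)) (cong ((i + j) C_) (m+n∸m≡n i j))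

pointed-zero : ∀ m → pointed m 1 + pointed m 1 ≡ pointed (suc m) 0
pointed-zero m = begin
  suc (m + m) C m + suc (m + m) C m       ≡⟨ cong (λ i → i C m + i C m) (+-suc m m) ⟨
  (m + suc m) C m + (m + suc m) C m       ≡⟨ cong (λ i → (m + suc m) C m + i) (C-symmetric m (suc m)) ⟩
  (m + suc m) C m + (m + suc m) C (suc m) ≡⟨ nCk+nC[k+1]≡[n+1]C[k+1] (m + suc m) m ⟩
  suc (m + suc m) C suc m                 ∎
  where open ≡-Reasoning

-- A nonempty context is its innermost frame, carrying one tree on one of two
-- sides, and a context.
count-pointed : ∀ m r → Counts (Pointed.Weighs r m) (pointed m r)
count-pointed zero zero =
  ([] , []) ∷ [] , refl , [] ∷ [] ,
  λ { ([] , [])          → mk⇔ (λ _ → refl) (λ _ → here refl)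
    ; ((t ◁) ∷ c , []) → mk⇔ (λ { (here ()) ; (there ()) }) (λ ())
    ; ((▷ t) ∷ c , []) → mk⇔ (λ { (here ()) ; (there ()) }) (λ ()) }
count-pointed zero (suc r) =
  Pointed.count-weight-zero (count-pointed zero r)
count-pointed (suc m) zero =
  count-≡ (setoid _) (pointed-zero m)
    (count-⇔ (setoid _) eq
      (count-⊎ (setoid _) (λ { _ ((_ , _ ∷ []) , _ , refl) ((_ , _ ∷ []) , _ , ()) })
        (count-map (addFrame _◁) (λ { {_ , _ ∷ []} {_ , _ ∷ []} refl → refl }) (count-pointed m 1))
        (count-map (addFrame ▷_) (λ { {_ , _ ∷ []} {_ , _ ∷ []} refl → refl }) (count-pointed m 1))))
  where
  addFrame : (Tree → Frame) → Context × Vec Tree 1 → Context × Vec Tree 0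
  addFrame f (c , t ∷ []) = f t ∷ c , []
  eq : ∀ y → (Image (addFrame _◁) (Pointed.Weighs 1 m) y ⊎ Image (addFrame ▷_) (Pointed.Weighs 1 m) y)
           ⇔ Pointed.Weighs 0 (suc m) y
  eq ([] , []) = mk⇔ (λ { (inj₁ ((_ , _ ∷ []) , _ , ())) ; (inj₂ ((_ , _ ∷ []) , _ , ())) }) (λ ())
  eq ((t ◁) ∷ c , []) =
    mk⇔ (λ { (inj₁ ((_ , _ ∷ []) , w , refl)) →
               cong suc (trans (cong (_+ contextSize c) (sym (+-identityʳ (size t)))) w)
           ; (inj₂ ((_ , _ ∷ []) , _ , ())) })
        (λ w → inj₁ (_ , trans (cong (_+ contextSize c) (+-identityʳ (size t)))
                             (suc-injective w) , refl))
  eq ((▷ t) ∷ c , []) =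
    mk⇔ (λ { (inj₂ ((_ , _ ∷ []) , w , refl)) →
               cong suc (trans (cong (_+ contextSize c) (sym (+-identityʳ (size t)))) w)
           ; (inj₁ ((_ , _ ∷ []) , _ , ())) })
        (λ w → inj₂ (_ , trans (cong (_+ contextSize c) (+-identityʳ (size t)))
                             (suc-injective w) , refl))
count-pointed (suc m) (suc r) =
  count-≡ (setoid _) (pointed-suc m r)
    (Pointed.count-weight-suc (count-pointed (suc m) r) (count-pointed m (2 + r)))

-- The number of forests of r trees of total size m.
ballot : ℕ → ℕ → ℕ
ballot zero    zero    = 1
ballot zero    (suc r) = ballot zero r
ballot (suc m) zero    = 0
ballot (suc m) (suc r) = ballot (suc m) r + ballot m (2 + r)

count-forests : ∀ m r → Counts (Plain.Weighs r m) (ballot m r)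
count-forests zero zero =
  (tt , []) ∷ [] , refl , [] ∷ [] , λ { (tt , []) → mk⇔ (λ _ → refl) (λ _ → here refl) }
count-forests zero (suc r) = Plain.count-weight-zero (count-forests zero r)
count-forests (suc m) zero = count-none (setoid _) (λ { (_ , []) () })
count-forests (suc m) (suc r) =
  Plain.count-weight-suc (count-forests (suc m) r) (count-forests m (2 + r))

ballot-zero : ∀ r → ballot 0 r ≡ 1
ballot-zero zero    = refl
ballot-zero (suc r) = ballot-zero r

-- A pair of a context and r trees has either the empty context, or one of two
-- sides for the innermost frame and one more tree.
ballot-pointed : ∀ m r → ballot (suc m) r + 2 * pointed m (suc r) ≡ pointed (suc m) r
ballot-pointed m zero =
  trans (cong (λ i → pointed m 1 + i) (+-identityʳ (pointed m 1))) (pointed-zero m)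
ballot-pointed zero (suc r) = begin
  ballot 1 r + ballot 0 r + 2 * pointed 0 (2 + r)
    ≡⟨ +-comm-middle (ballot 1 r) (ballot 0 r) _ ⟩
  (ballot 1 r + 2 * pointed 0 (suc r)) + ballot 0 r
    ≡⟨ cong₂ _+_ (ballot-pointed 0 r) (ballot-zero r) ⟩
  pointed 1 r + pointed 0 (2 + r)
    ≡⟨ pointed-suc 0 r ⟩
  pointed 1 (suc r) ∎
  where
  open ≡-Reasoning
  +-comm-middle : ∀ x y z → x + y + z ≡ x + z + y
  +-comm-middle = solve-∀
ballot-pointed (suc m) (suc r) = begin
  u + v + 2 * pointed (suc m) (2 + r)
    ≡⟨ cong (λ i → u + v + 2 * i) (pointed-suc m (suc r)) ⟨
  u + v + 2 * (x + y)
    ≡⟨ regroup u v x y ⟩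
  (u + 2 * x) + (v + 2 * y)
    ≡⟨ cong₂ _+_ (ballot-pointed (suc m) r) (ballot-pointed m (2 + r)) ⟩
  pointed (2 + m) r + pointed (suc m) (2 + r)
    ≡⟨ pointed-suc (suc m) r ⟩
  pointed (2 + m) (suc r) ∎
  where
  open ≡-Reasoning
  u = ballot (2 + m) r
  v = ballot (suc m) (2 + r)
  x = pointed (suc m) (suc r)
  y = pointed m (3 + r)
  regroup : ∀ u v x y → u + v + 2 * (x + y) ≡ (u + 2 * x) + (v + 2 * y)
  regroup = solve-∀

-- With A = C(2n, n) and B = C(2n, n-1), the number g of trees of size n is A - B,
-- and (n+1) B = n A, so (n+1) g = A.
catalan : ∀ m → ballot (suc m) 1 ≡ ((2 * suc m) C suc m) / suc (suc m)
catalan m = trans (sym (m*n/n≡m g (suc n))) (cong (_/ suc n) (trans (*-comm g (suc n)) product))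
  where
  open ≡-Reasoning
  n = suc m
  N = suc (suc (m + m))
  A = N C n
  B = N C m
  g = ballot n 1
  N≡2n : N ≡ 2 * n
  N≡2n = cong suc (trans (sym (+-suc m m)) (cong (λ i → m + suc i) (sym (+-identityʳ m))))
  double : ∀ g b → g + 2 * b ≡ (g + b) + b
  double = solve-∀
  g+B≡A : g + B ≡ A
  g+B≡A = +-cancelʳ-≡ B _ _ (begin
    (g + B) + B       ≡⟨ double g B ⟨
    g + 2 * B         ≡⟨ ballot-pointed m 1 ⟩
    pointed n 1       ≡⟨ cong (λ i → suc i C n) (shift m 0) ⟩
    suc N C n         ≡⟨ nCk+nC[k+1]≡[n+1]C[k+1] N m ⟨
    B + A             ≡⟨ +-comm B A ⟩
    A + B             ∎)
  B-symmetric : B ≡ N C suc n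
  B-symmetric = begin
    N C m               ≡⟨ cong (_C m) (N≡ m) ⟩
    (m + suc n) C m     ≡⟨ C-symmetric m (suc n) ⟩
    (m + suc n) C suc n ≡⟨ cong (_C suc n) (N≡ m) ⟨
    N C suc n           ∎
    where
    N≡ : ∀ m → suc (suc (m + m)) ≡ m + suc (suc m)
    N≡ = solve-∀
  suc-n*B : suc n * B ≡ n * A
  suc-n*B = +-cancelˡ-≡ (suc n * A) _ _ (begin
    suc n * A + suc n * B         ≡⟨ *-distribˡ-+ (suc n) A B ⟨
    suc n * (A + B)               ≡⟨ cong (λ i → suc n * (A + i)) B-symmetric ⟩
    suc n * (A + N C suc n)       ≡⟨ cong (suc n *_) (nCk+nC[k+1]≡[n+1]C[k+1] N n) ⟩
    suc n * (suc N C suc n)       ≡⟨ absorption N n ⟩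
    suc N * A                     ≡⟨ expand m A ⟩
    suc n * A + n * A             ∎)
    where
    expand : ∀ m A → suc (suc (suc (m + m))) * A ≡ suc (suc m) * A + suc m * A
    expand = solve-∀
  product : suc n * g ≡ (2 * n) C n
  product = trans (+-cancelʳ-≡ (n * A) _ _ (begin
    suc n * g + n * A     ≡⟨ cong (λ i → suc n * g + i) suc-n*B ⟨
    suc n * g + suc n * B ≡⟨ *-distribˡ-+ (suc n) g B ⟨
    suc n * (g + B)       ≡⟨ cong (suc n *_) g+B≡A ⟩
    A + n * A             ∎)) (cong (_C n) N≡2n)

-- Endpoints determine the context and the filled trees

-- A frame around a tree; folding it over the reversed context rebuilds the
-- tree from the root, where two plugged trees can be compared.
surround : Frame → Tree → Tree
surround (r ◁) T = node T r
surround (▷ l) T = node l T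

plug-reverse : ∀ c T → plug c T ≡ foldr surround T (reverse c)
plug-reverse []       T = refl
plug-reverse (f ∷ c)  T = trans (step f) (trans (plug-reverse c (surround f T))
  (sym (trans (cong (foldr surround T) (unfold-reverse f c)) (foldr-∷ʳ surround T f (reverse c)))))
  where
  step : ∀ f → plug (f ∷ c) T ≡ plug c (surround f T)
  step (r ◁) = refl
  step (▷ l) = refl

-- Two nodes differing in both sons.
data Apart : Tree → Tree → Set where
  apart : ∀ {L L′ R R′} → L ≢ L′ → R ≢ R′ → Apart (node L R) (node L′ R′)

apart⇒≢ : ∀ {P Q} → Apart P Q → P ≢ Q
apart⇒≢ (apart ne _) refl = ne refl

surround-injective : ∀ fs {S T} → foldr surround S fs ≡ foldr surround T fs → S ≡ T
surround-injective []           eq = eq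
surround-injective ((r ◁) ∷ fs) eq = surround-injective fs (proj₁ (node-injective eq))
surround-injective ((▷ l) ∷ fs) eq = surround-injective fs (proj₂ (node-injective eq))

-- The hole is the lowest place containing all differences of the two trees,
-- because a pair that is apart differs in both sons of its root.
apart-unique : ∀ {P Q P′ Q′} → Apart P Q → Apart P′ Q′ → ∀ fs fs′ →
  foldr surround P fs ≡ foldr surround P′ fs′ → foldr surround Q fs ≡ foldr surround Q′ fs′ →
  fs ≡ fs′ × P ≡ P′ × Q ≡ Q′
apart-unique _ _ [] [] e e′ = refl , e , e′
apart-unique (apart _ ne) _ [] ((r ◁) ∷ fs′) refl e′ =
  contradiction (sym (proj₂ (node-injective e′))) ne
apart-unique (apart ne _) _ [] ((▷ l) ∷ fs′) refl e′ =
  contradiction (sym (proj₁ (node-injective e′))) ne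
apart-unique _ (apart _ ne) ((r ◁) ∷ fs) [] refl e′ =
  contradiction (proj₂ (node-injective e′)) ne
apart-unique _ (apart ne _) ((▷ l) ∷ fs) [] refl e′ =
  contradiction (proj₁ (node-injective e′)) ne
apart-unique u v ((r ◁) ∷ fs) ((r′ ◁) ∷ fs′) e e′
  with refl ← proj₂ (node-injective e)
  with refl , eqs ← apart-unique u v fs fs′ (proj₁ (node-injective e)) (proj₁ (node-injective e′))
  = refl , eqs
apart-unique u v ((▷ l) ∷ fs) ((▷ l′) ∷ fs′) e e′
  with refl ← proj₁ (node-injective e)
  with refl , eqs ← apart-unique u v fs fs′ (proj₂ (node-injective e)) (proj₂ (node-injective e′))
  = refl , eqs
apart-unique u _ ((r ◁) ∷ fs) ((▷ l) ∷ fs′) e e′ =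
  contradiction
    (surround-injective fs
      (trans (proj₁ (node-injective e)) (sym (proj₁ (node-injective e′)))))
    (apart⇒≢ u)
apart-unique u _ ((▷ l) ∷ fs) ((r ◁) ∷ fs′) e e′ =
  contradiction
    (surround-injective fs
      (trans (proj₂ (node-injective e)) (sym (proj₂ (node-injective e′)))))
    (apart⇒≢ u)

plug-unique : ∀ {P Q P′ Q′} → Apart P Q → Apart P′ Q′ → ∀ c c′ →
  plug c P ≡ plug c′ P′ → plug c Q ≡ plug c′ Q′ → c ≡ c′ × P ≡ P′ × Q ≡ Q′
plug-unique u v c c′ e e′
  with eq , eqs ← apart-unique u v (reverse c) (reverse c′)
                    (trans (sym (plug-reverse c _)) (trans e (plug-reverse c′ _)))
                    (trans (sym (plug-reverse c _)) (trans e′ (plug-reverse c′ _)))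
  = reverse-injective eq , eqs

size-leftComb-≤ : ∀ {k} (cs : Vec Tree k) T → size T ≤ size (leftComb cs T)
size-leftComb-≤ []       T = ≤-refl
size-leftComb-≤ (c ∷ cs) T = ≤-trans (size-leftComb-≤ cs T) (<⇒≤ (size-left< _ c))

size-right< : ∀ U V → size V < size (node U V)
size-right< U V = s≤s (m≤n+m (size V) (size U))

slide-apart : ∀ {k} (ts : Vec Tree (3 + k)) → Apart (slideBottom ts) (slideTop ts)
slide-apart (B ∷ X ∷ c ∷ cs) =
  apart (λ eq → <⇒≢ (<-≤-trans (size-left< B X) (size-leftComb-≤ cs (node B X))) (cong size eq))
        (λ eq → <⇒≢ (size-right< (leftComb cs X) c) (cong size (sym eq)))

rightComb-apart : ∀ {k} (as : Vec Tree k) {a T S D} → size a < size S → size D < size T →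
                  Apart (rightComb as (node a T)) (node (rightComb as S) D)
rightComb-apart []       lt lt′ =
  apart (λ eq → <⇒≢ lt (cong size eq)) (λ eq → <⇒≢ lt′ (cong size (sym eq)))
rightComb-apart (b ∷ as) {a} {T} {S} lt lt′ =
  rightComb-apart as (size-left< b S) (<-trans lt′ (size-right< a T))

lift-apart : ∀ {k} (ts : Vec Tree (3 + k)) → Apart (liftBottom ts) (liftTop ts)
lift-apart (Y ∷ Z ∷ a ∷ as) = rightComb-apart as (size-left< a Y) (size-right< Y Z)

leftComb-injective : ∀ {k} (cs cs′ : Vec Tree k) {S T} →
                     leftComb cs S ≡ leftComb cs′ T → cs ≡ cs′ × S ≡ T
leftComb-injective []       []         e = refl , e
leftComb-injective (c ∷ cs) (c′ ∷ cs′) e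
  with refl , refl ← leftComb-injective cs cs′ (proj₁ (node-injective e))
     | refl ← proj₂ (node-injective e)
  = refl , refl

rightComb-injective : ∀ {k} (as as′ : Vec Tree k) {S T} →
                      rightComb as S ≡ rightComb as′ T → as ≡ as′ × S ≡ T
rightComb-injective []       []         e = refl , e
rightComb-injective (a ∷ as) (a′ ∷ as′) e
  with refl , refl ← rightComb-injective as as′ e = refl , refl

slideBottom-injective : ∀ {k} (ts ts′ : Vec Tree (2 + k)) →
                        slideBottom ts ≡ slideBottom ts′ → ts ≡ ts′
slideBottom-injective (B ∷ X ∷ cs) (B′ ∷ X′ ∷ cs′) e
  with refl ← proj₁ (node-injective e)
     | refl , refl ← leftComb-injective cs cs′ (proj₂ (node-injective e))
  = refl

liftBottom-injective : ∀ {k} (ts ts′ : Vec Tree (2 + k)) →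
                       liftBottom ts ≡ liftBottom ts′ → ts ≡ ts′
liftBottom-injective (Y ∷ Z ∷ as) (Y′ ∷ Z′ ∷ as′) e
  with refl , refl ← rightComb-injective as as′ e = refl

-- The left son of the root of a nonempty right comb does not depend on the
-- tree hung at its end.
rightComb-root : ∀ {k} (as : Vec Tree k) a →
                 ∃[ b ] (∀ T → ∃[ T′ ] rightComb as (node a T) ≡ node b T′)
rightComb-root []       a = a , λ T → T , refl
rightComb-root (b ∷ as) a with c , h ← rightComb-root as b = c , λ T → h (node a T)

-- In a lift of height at least 2 the bottom and the left son of the top have
-- the same left son; in a slide that of the bottom is B, and that of the left
-- son of the top contains node B X.
slide≢lift : ∀ {k} (ts us : Vec Tree (4 + k)) →
             slideBottom ts ≡ liftBottom us → slideTop ts ≡ liftTop us → ⊥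
slide≢lift (B ∷ X ∷ c ∷ d ∷ cs) (Y ∷ Z ∷ a ∷ as) e e′
  with b , h ← rightComb-root as a
  with _ , e₁ ← h (node Y Z) | _ , e₂ ← h Y
  = <⇒≢ (<-≤-trans (size-left< B X) (size-leftComb-≤ cs (node B X)))
      (cong size (trans (proj₁ (node-injective (trans e e₁)))
                        (sym (proj₁ (node-injective (trans (proj₁ (node-injective e′)) e₂))))))

-- Sizes of the endpoints

size-plug : ∀ c T → size (plug c T) ≡ size T + contextSize c
size-plug []           T = sym (+-identityʳ (size T))
size-plug ((r ◁) ∷ c) T = trans (size-plug c (node T r)) (eq (size T) (size r) (contextSize c))
  where
  eq : ∀ t r c → suc (t + r + c) ≡ t + suc (r + c)
  eq = solve-∀
size-plug ((▷ l) ∷ c) T = trans (size-plug c (node l T)) (eq (size T) (size l) (contextSize c))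
  where
  eq : ∀ t r c → suc (r + t + c) ≡ t + suc (r + c)
  eq = solve-∀

size-leftComb : ∀ {k} (cs : Vec Tree k) T → size (leftComb cs T) ≡ k + (size T + forestSize cs)
size-leftComb []       T = sym (+-identityʳ (size T))
size-leftComb {suc k} (c ∷ cs) T =
  cong suc (trans (cong (_+ size c) (size-leftComb cs T)) (eq k (size T) (forestSize cs) (size c)))
  where
  eq : ∀ k t f c → k + (t + f) + c ≡ k + (t + (c + f))
  eq = solve-∀

size-rightComb : ∀ {k} (as : Vec Tree k) T → size (rightComb as T) ≡ k + (size T + forestSize as)
size-rightComb []       T = sym (+-identityʳ (size T))
size-rightComb {suc k} (a ∷ as) T =
  trans (size-rightComb as (node a T)) (eq k (size T) (forestSize as) (size a))
  where
  eq : ∀ k t f a → k + (suc (a + t) + f) ≡ suc (k + (t + (a + f)))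
  eq = solve-∀

size-slideBottom : ∀ {k} (ts : Vec Tree (2 + k)) → size (slideBottom ts) ≡ suc k + forestSize ts
size-slideBottom {k} (B ∷ X ∷ cs) =
  cong suc (trans (cong (λ i → size B + i) (size-leftComb cs X))
                  (eq k (size B) (size X + forestSize cs)))
  where
  eq : ∀ k b t → b + (k + t) ≡ k + (b + t)
  eq = solve-∀

size-liftBottom : ∀ {k} (ts : Vec Tree (2 + k)) → size (liftBottom ts) ≡ suc k + forestSize ts
size-liftBottom {k} (Y ∷ Z ∷ as) =
  trans (size-rightComb as (node Y Z)) (eq k (size Y) (size Z) (forestSize as))
  where
  eq : ∀ k c d t → k + (suc (c + d) + t) ≡ suc (k + (c + (d + t)))
  eq = solve-∀

-- Counting intervals by height

module _ (k : ℕ) where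

  -- A tree built from k + 2 trees.
  Family : Set
  Family = Vec Tree (2 + k) → Tree

  -- The pairs obtained from bot and top with common trees and context.
  Instance : Family → Family → ∀ {n} → Pred (Setoid.Carrier (Intervals.Endpoints (Tam n))) 0ℓ
  Instance bot top ((P , _) , (Q , _)) =
    ∃[ c ] ∃[ ts ] P ≡ plug c (bot ts) × Q ≡ plug c (top ts)

  count-instances : (bot top : Family) →
    (∀ ts → Thread (bot ts) (top ts) k) →
    (∀ ts → Apart (bot ts) (top ts)) →
    (∀ ts ts′ → bot ts ≡ bot ts′ → ts ≡ ts′) →
    (∀ ts → size (bot ts) ≡ suc k + forestSize ts) →
    ∀ {n d} → n ≡ suc k + d →
    HasCount (Intervals.Endpoints (Tam n)) (Instance bot top) (pointed d (2 + k))
  count-instances bot top th ap inj sz {n} {d} n≡ =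
    count-image E ends (λ _ _ → refl , refl) ends-injective
      (λ y → mk⇔ (complete y) (λ { ((c , ts) , _ , e , e′) → c , ts , e , e′ }))
      (count-pointed d (2 + k))
    where
    E = Intervals.Endpoints (Tam n)
    W = Pointed.Weighs (2 + k) d
    bot-size : ∀ c ts → size (plug c (bot ts)) ≡ suc k + (forestSize ts + contextSize c)
    bot-size c ts =
      trans (size-plug c (bot ts))
        (trans (cong (_+ contextSize c) (sz ts)) (+-assoc (suc k) (forestSize ts) _))
    bot-size-n : ∀ c ts → W (c , ts) → size (plug c (bot ts)) ≡ n
    bot-size-n c ts w = trans (bot-size c ts) (trans (cong (λ i → suc k + i) w) (sym n≡))
    ends : ∀ x → W x → Setoid.Carrier E
    ends (c , ts) w =
      (plug c (bot ts) , bot-size-n c ts w) ,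
      (plug c (top ts) , trans (sym (thread-size (plug-thread c (th ts)))) (bot-size-n c ts w))
    ends-injective : ∀ {x y} (u : W x) (v : W y) → Setoid._≈_ E (ends x u) (ends y v) → x ≡ y
    ends-injective {c , ts} {c′ , ts′} _ _ (e , e′)
      with refl , f , _ ← plug-unique (ap ts) (ap ts′) c c′ e e′
      with refl ← inj ts ts′ f = refl
    complete : ∀ y → Instance bot top y → ∃[ x ] Σ (W x) λ u → Setoid._≈_ E y (ends x u)
    complete ((P , p) , (Q , q)) (c , ts , refl , refl) =
      (c , ts) , +-cancelˡ-≡ (suc k) _ _ (trans (sym (bot-size c ts)) (trans p n≡)) , refl , refl

k<size-plug : ∀ {k} c T {f} → size T ≡ suc k + f → k < size (plug c T)
k<size-plug {k} c T {f} eq =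
  subst (k <_) (sym (size-plug c T))
    (≤-trans (s≤s (m≤m+n k f)) (≤-trans (≤-reflexive (sym eq)) (m≤m+n (size T) (contextSize c))))

pattern-height< : ∀ {k P Q} → Pattern k P Q → 1 ≤ size P → k < size P
pattern-height< trivial      pos = pos
pattern-height< (slide c ts) _ = k<size-plug c (slideBottom ts) (size-slideBottom ts)
pattern-height< (lift c ts)  _ = k<size-plug c (liftBottom ts) (size-liftBottom ts)

module _ {n : ℕ} where

  open Intervals (Tam n)

  height<size : 1 ≤ n → ∀ {k I} → LinearIntervalOfHeight k I → k < n
  height<size pos {k} {(P , eq) , _} i =
    subst (k <_) eq (pattern-height< (interval⇒pattern i) (subst (1 ≤_) (sym eq) pos))

  height-unique : ∀ {j k I} → LinearIntervalOfHeight j I → LinearIntervalOfHeight k I → j ≡ k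
  height-unique (_ , ch , mx) (_ , ch′ , mx′) = ≤-antisym (mx′ ch) (mx ch′)

  linear⇒height : ∀ {I} → LinearInterval I → ∃[ k ] LinearIntervalOfHeight k I
  linear⇒height {P , Q} (le , lin)
    with k , pat ← linear⇒pattern le (linearTree {P = P} {Q} (λ {R} {S} → lin {R} {S}))
    = k , pattern⇒interval pat

  count-height-one : ∀ {d} → n ≡ 2 + d → HasCount Endpoints (LinearIntervalOfHeight 1) (pointed d 3)
  count-height-one n≡ =
    count-⇔ Endpoints (λ y → mk⇔ (sound y) (λ i → complete y (interval⇒pattern i)))
      (count-instances 1 slideBottom slideTop
        slide-thread slide-apart slideBottom-injective size-slideBottom n≡)
    where
    sound : ∀ y → Instance 1 slideBottom slideTop y → LinearIntervalOfHeight 1 y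
    sound ((_ , p) , (_ , q)) (c , ts , refl , refl) = pattern⇒interval (slide c ts)
    complete : ∀ y → Pattern 1 (proj₁ (proj₁ y)) (proj₁ (proj₂ y)) →
               Instance 1 slideBottom slideTop y
    complete _ (slide c ts) = c , ts , refl , refl

  count-height-≥2 : ∀ {k d} → n ≡ suc (2 + k) + d →
                    HasCount Endpoints (LinearIntervalOfHeight (2 + k)) (2 * pointed d (4 + k))
  count-height-≥2 {k} {d} n≡ =
    count-≡ Endpoints (cong (λ i → pointed d (4 + k) + i) (sym (+-identityʳ _)))
      (count-⇔ Endpoints (λ y → mk⇔ (sound y) (λ i → complete y (interval⇒pattern i)))
        (count-⊎ Endpoints disjoint
          (count-instances (2 + k) slideBottom slideTop
            slide-thread slide-apart slideBottom-injective size-slideBottom n≡)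
          (count-instances (2 + k) liftBottom liftTop
            lift-thread lift-apart liftBottom-injective size-liftBottom n≡)))
    where
    S L : Pred (Setoid.Carrier Endpoints) 0ℓ
    S = Instance (2 + k) slideBottom slideTop
    L = Instance (2 + k) liftBottom liftTop
    disjoint : ∀ y → S y → ¬ L y
    disjoint _ (c , ts , refl , refl) (c′ , us , e , e′)
      with _ , f , f′ ← plug-unique (slide-apart ts) (lift-apart us) c c′ e e′
      = slide≢lift ts us f f′
    sound : ∀ y → S y ⊎ L y → LinearIntervalOfHeight (2 + k) y
    sound ((_ , p) , (_ , q)) (inj₁ (c , ts , refl , refl)) = pattern⇒interval (slide c ts)
    sound ((_ , p) , (_ , q)) (inj₂ (c , ts , refl , refl)) = pattern⇒interval (lift c ts)
    complete : ∀ y → Pattern (2 + k) (proj₁ (proj₁ y)) (proj₁ (proj₂ y)) → S y ⊎ L y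
    complete _ (slide c ts) = inj₁ (c , ts , refl , refl)
    complete _ (lift c ts)  = inj₂ (c , ts , refl , refl)

  count-height-zero : HasCount Endpoints (LinearIntervalOfHeight 0) (ballot n 1)
  count-height-zero =
    count-image Endpoints diagonal
      (λ { {_ , _ ∷ []} _ _ → refl , refl })
      (λ { {_ , _ ∷ []} {_ , _ ∷ []} _ _ (refl , _) → refl })
      (λ y → mk⇔ (λ i → complete y (interval⇒pattern i)) (sound y))
      (count-forests n 1)
    where
    W = Plain.Weighs 1 n
    strip : ∀ t → size t + 0 + 0 ≡ size t
    strip t = trans (+-identityʳ _) (+-identityʳ _)
    diagonal : ∀ x → W x → Setoid.Carrier Endpoints
    diagonal (_ , t ∷ []) w = (t , trans (sym (strip t)) w) , (t , trans (sym (strip t)) w)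
    sound : ∀ y → (∃[ x ] Σ (W x) λ u → Setoid._≈_ Endpoints y (diagonal x u)) →
            LinearIntervalOfHeight 0 y
    sound ((P , p) , (Q , q)) ((_ , t ∷ []) , _ , refl , refl) = pattern⇒interval trivial
    complete : ∀ y → Pattern 0 (proj₁ (proj₁ y)) (proj₁ (proj₂ y)) →
               ∃[ x ] Σ (W x) λ u → Setoid._≈_ Endpoints y (diagonal x u)
    complete ((P , p) , _) trivial = (tt , P ∷ []) , trans (strip P) p , refl , refl

  -- The induction on d = n - (2 + k) lowers the least height considered.  Each
  -- step is Pascal's rule C(N, n+1) + C(N, n+2) = C(N+1, n+2) with N = n + d + 1,
  -- since the summand is 2 C(N, d) = 2 C(N, n+1).  It starts from no interval of
  -- height n or more.
  count-height-≥ : 1 ≤ n → ∀ d {k} → n ≡ 2 + k + d →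
    HasCount Endpoints (λ I → ∃[ j ] 2 + k ≤ j × LinearIntervalOfHeight j I)
             (2 * (suc (n + d) C (n + 2)))
  count-height-≥ pos zero {k} n≡ =
    count-≡ Endpoints (cong (2 *_) (sym (k>n⇒nCk≡0 n+1<n+2)))
      (count-none Endpoints λ { I (j , le , i) →
        <⇒≱ (height<size pos {I = I} i) (subst (_≤ j) (sym (trans n≡ (+-identityʳ _))) le) })
    where
    n+1<n+2 : suc (n + 0) < n + 2
    n+1<n+2 = ≤-reflexive (eq n)
      where
      eq : ∀ n → suc (suc (n + 0)) ≡ n + 2
      eq = solve-∀
  count-height-≥ pos (suc d) {k} n≡ =
    count-≡ Endpoints value
      (count-⇔ Endpoints (λ I → mk⇔ (join I) (split I))
        (count-⊎ Endpoints (λ { I i (j , le , i′) → <⇒≢ le (height-unique {I = I} i i′) })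
          (count-height-≥2 n≡′) (count-height-≥ pos d n≡′)))
    where
    n≡′ : n ≡ suc (2 + k) + d
    n≡′ = trans n≡ (+-suc (2 + k) d)
    join : ∀ I → LinearIntervalOfHeight (2 + k) I ⊎ (∃[ j ] 3 + k ≤ j × LinearIntervalOfHeight j I) →
           ∃[ j ] 2 + k ≤ j × LinearIntervalOfHeight j I
    join _ (inj₁ i)            = _ , ≤-refl , i
    join _ (inj₂ (j , le , i)) = j , <⇒≤ le , i
    split : ∀ I → (∃[ j ] 2 + k ≤ j × LinearIntervalOfHeight j I) →
            LinearIntervalOfHeight (2 + k) I ⊎ (∃[ j ] 3 + k ≤ j × LinearIntervalOfHeight j I)
    split _ (j , le , i) with m≤n⇒m<n∨m≡n le
    ... | inj₁ lt   = inj₂ (j , lt , i)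
    ... | inj₂ refl = inj₁ i
    open ≡-Reasoning
    total : ∀ k d → 4 + k + (d + d) ≡ d + suc (suc (suc k) + suc d)
    total = solve-∀
    pointed≡ : pointed d (4 + k) ≡ suc (n + d) C suc n
    pointed≡ = begin
      (4 + k + (d + d)) C d ≡⟨ cong (_C d) (trans (total k d) (cong (λ i → d + suc i) (sym n≡))) ⟩
      (d + suc n) C d       ≡⟨ C-symmetric d (suc n) ⟩
      (d + suc n) C suc n   ≡⟨ cong (_C suc n) (+-comm d (suc n)) ⟩
      suc (n + d) C suc n   ∎
    value : 2 * pointed d (4 + k) + 2 * (suc (n + d) C (n + 2)) ≡ 2 * (suc (n + suc d) C (n + 2))
    value = begin
      2 * pointed d (4 + k) + 2 * (suc (n + d) C (n + 2))
        ≡⟨ *-distribˡ-+ 2 (pointed d (4 + k)) _ ⟨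
      2 * (pointed d (4 + k) + suc (n + d) C (n + 2))
        ≡⟨ cong₂ (λ i j → 2 * (i + suc (n + d) C j)) pointed≡ (+-comm n 2) ⟩
      2 * (suc (n + d) C suc n + suc (n + d) C suc (suc n))
        ≡⟨ cong (2 *_) (nCk+nC[k+1]≡[n+1]C[k+1] (suc (n + d)) (suc n)) ⟩
      2 * (suc (suc (n + d)) C suc (suc n))
        ≡⟨ cong₂ (λ i j → 2 * (suc i C j)) (sym (+-suc n d)) (+-comm 2 n) ⟩
      2 * (suc (n + suc d) C (n + 2)) ∎

-- Integer differences that are natural numbers.
binom-⊖ : ∀ b d e f {a c} → a ≡ e + b → c ≡ f + d → binom (a ⊖ b) (c ⊖ d) ≡ e C f
binom-⊖ b d e f refl refl =
  cong₂ binom (trans (⊖-≥ (m≤n+m b e)) (cong +_ (m+n∸n≡m e b)))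
              (trans (⊖-≥ (m≤n+m d f)) (cong +_ (m+n∸n≡m f d)))

theorem2p4 : ∀ (n : ℕ) → 1 ≤ n → let open Intervals (Tam n) in
    HasCount Endpoints (LinearIntervalOfHeight 0) (binom (+ (2 * n)) (+ n) / suc n)
    × HasCount Endpoints (LinearIntervalOfHeight 1) (binom (2 * n ⊖ 1) (n ⊖ 2))
    × (∀ k → 2 ≤ k → k < n →
    HasCount Endpoints (LinearIntervalOfHeight k) (2 * binom (2 * n ⊖ k) (n ⊖ (k + 1))))
    × (∀ k → n ≤ k → ∀ I → ¬ LinearIntervalOfHeight k I)
    × HasCount Endpoints LinearInterval
    (binom (+ (2 * n)) (+ n) / suc n + binom (2 * n ⊖ 1) (n ⊖ 2)
    + 2 * binom (2 * n ⊖ 1) (+ (n + 2)))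
theorem2p4 n@(suc m) pos = height0 , height1 m refl , height2 , bounded , total
  where
  open Intervals (Tam n)

  height0 : HasCount Endpoints (LinearIntervalOfHeight 0) (binom (+ (2 * n)) (+ n) / suc n)
  height0 = count-≡ Endpoints (catalan m) count-height-zero

  bounded : ∀ k → n ≤ k → ∀ I → ¬ LinearIntervalOfHeight k I
  bounded k n≤k I i = <⇒≱ (height<size pos {I = I} i) n≤k

  height1 : ∀ m′ → m ≡ m′ → HasCount Endpoints (LinearIntervalOfHeight 1) (binom (2 * n ⊖ 1) (n ⊖ 2))
  height1 zero    refl = count-none Endpoints (bounded 1 ≤-refl)
  height1 (suc d) refl =
    count-≡ Endpoints (sym (binom-⊖ 1 2 (3 + (d + d)) d (eq d) (+-comm 2 d))) (count-height-one refl)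
    where
    eq : ∀ d → 2 * (2 + d) ≡ 3 + (d + d) + 1
    eq = solve-∀

  height2 : ∀ k → 2 ≤ k → k < n →
    HasCount Endpoints (LinearIntervalOfHeight k) (2 * binom (2 * n ⊖ k) (n ⊖ (k + 1)))
  height2 (suc (suc k)) _ k<n =
    count-≡ Endpoints
      (cong (2 *_) (sym (binom-⊖ (2 + k) (2 + k + 1) (4 + k + (d + d)) d
        (trans (cong (2 *_) n≡) (eq k d)) (trans n≡ (eq′ k d)))))
      (count-height-≥2 {k = k} {d} n≡)
    where
    d = n ∸ (3 + k)
    n≡ : n ≡ 3 + k + d
    n≡ = sym (m+[n∸m]≡n k<n)
    eq : ∀ k d → 2 * (3 + k + d) ≡ 4 + k + (d + d) + (2 + k)
    eq = solve-∀
    eq′ : ∀ k d → 3 + k + d ≡ d + (2 + k + 1)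
    eq′ = solve-∀
  height2 (suc zero) (s≤s ()) _

  heights≥2 : ∀ m′ → m ≡ m′ →
    HasCount Endpoints (λ I → ∃[ j ] 2 ≤ j × LinearIntervalOfHeight j I)
             (2 * binom (2 * n ⊖ 1) (+ (n + 2)))
  heights≥2 zero    refl =
    count-none Endpoints λ { I (j , le , i) → bounded j (<⇒≤ le) I i }
  heights≥2 (suc d) refl =
    count-≡ Endpoints
      (cong (2 *_) (sym (binom-⊖ 1 0 (suc (2 + d + d)) (2 + d + 2) (eq d) (sym (+-identityʳ _)))))
      (count-height-≥ pos d refl)
    where
    eq : ∀ d → 2 * (2 + d) ≡ suc (2 + d + d) + 1
    eq = solve-∀

  total : HasCount Endpoints LinearInterval
    (binom (+ (2 * n)) (+ n) / suc n + binom (2 * n ⊖ 1) (n ⊖ 2)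
      + 2 * binom (2 * n ⊖ 1) (+ (n + 2)))
  total = count-⇔ Endpoints (λ I → mk⇔ (join I) (λ i → split I (linear⇒height i)))
    (count-⊎ Endpoints
      (λ { I (inj₁ i) (j , le , i′) → <⇒≢ (<-trans (s≤s z≤n) le) (height-unique {I = I} i i′)
         ; I (inj₂ i) (j , le , i′) → <⇒≢ le (height-unique {I = I} i i′) })
      (count-⊎ Endpoints (λ I i i′ → <⇒≢ (s≤s z≤n) (height-unique {I = I} i i′))
        height0 (height1 m refl))
      (heights≥2 m refl))
    where
    join : ∀ I → (LinearIntervalOfHeight 0 I ⊎ LinearIntervalOfHeight 1 I) ⊎
                 (∃[ j ] 2 ≤ j × LinearIntervalOfHeight j I) → LinearInterval I
    join _ (inj₁ (inj₁ i))      = proj₁ i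
    join _ (inj₁ (inj₂ i))      = proj₁ i
    join _ (inj₂ (_ , _ , i)) = proj₁ i
    split : ∀ I → ∃[ k ] LinearIntervalOfHeight k I →
            (LinearIntervalOfHeight 0 I ⊎ LinearIntervalOfHeight 1 I) ⊎
            (∃[ j ] 2 ≤ j × LinearIntervalOfHeight j I)
    split _ (0 , i)           = inj₁ (inj₁ i)
    split _ (1 , i)           = inj₁ (inj₂ i)
    split _ (suc (suc k) , i) = inj₂ (2 + k , s≤s (s≤s z≤n) , i)
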